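{- The identities (A8) $x\wedge(y\wedge z)\approx (z\wedge x)\wedge y$, (J5') $x\approx (x'\wedge y)'\wedge(x'\wedge y')'$ form a 2-base for the variety $\mathbb{BA}$ of Boolean algebras (in the language $\langle\wedge,{}'\rangle$).
   Context: Algebras are of type $\langle \wedge, {}'\rangle$ with $\wedge$ binary and ${}'$ unary. The variety $\mathbb{BA}$ of Boolean algebras in this language consists of the algebras $\langle B,\wedge,{}'\rangle$ obtained from Boolean algebras by keeping only meet and complement (equivalently, the variety generated by the two-element Boolean algebra with meet and complement). A base for a variety is an independent set of identities (no identity in the set follows from the others) that defines the variety; an $n$-base is a base with exactly $n$ identities. -}

module Defs where

open import Algebra.Core using (Op₁; Op₂)
open import Algebra.Definitions using (Congruent₁; Congruent₂)
open import Algebra.Lattice.Structures using (IsBooleanAlgebra)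
open import Data.Fin using (Fin)
open import Data.Nat using (ℕ)
open import Data.Product using (Σ-syntax; _×_)
open import Data.Vec using (Vec; lookup)
open import Function.Bundles using (_⇔_)
open import Level using (suc; _⊔_)
open import Relation.Binary.Core using (Rel)
open import Relation.Binary.Structures using (IsEquivalence)
open import Relation.Binary.PropositionalEquality using (_≢_)
open import Relation.Nullary using (¬_)

infixr 7 _∧_
infix  8 _′
infix  4 _≈_

-- Algebras of type ⟨∧, ′⟩, over a setoid as in the standard library.  Carriers
-- are non-empty, as usual in universal algebra; since the type has no constant
-- symbols this has to be required separately.  The element `point` is only a
-- witness of non-emptiness: it is not an operation and no term refers to it.

record Algebra c ℓ : Set (suc (c ⊔ ℓ)) where
  field
    Carrier       : Set c
    _≃_           : Rel Carrier ℓ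
    isEquivalence : IsEquivalence _≃_
    meet          : Op₂ Carrier
    compl         : Op₁ Carrier
    meet-cong     : Congruent₂ _≃_ meet
    compl-cong    : Congruent₁ _≃_ compl
    point         : Carrier

data Term : Set where
  var : ℕ → Term
  _∧_ : Term → Term → Term
  _′  : Term → Term

record Identity : Set where
  constructor _≈_
  field
    lhs rhs : Term

module _ {c ℓ} (A : Algebra c ℓ) where
  open Algebra A

  ⟦_⟧ : Term → (ℕ → Carrier) → Carrier
  ⟦ var i ⟧ ρ = ρ i
  ⟦ s ∧ t ⟧ ρ = meet (⟦ s ⟧ ρ) (⟦ t ⟧ ρ)
  ⟦ t ′   ⟧ ρ = compl (⟦ t ⟧ ρ)

  infix 4 _⊨_
  _⊨_ : Identity → Set (c ⊔ ℓ)
  _⊨_ (s ≈ t) = ∀ (ρ : ℕ → Carrier) → ⟦ s ⟧ ρ ≃ ⟦ t ⟧ ρ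

Class : ∀ c ℓ → Set (suc (c ⊔ ℓ))
Class c ℓ = Algebra c ℓ → Set (c ⊔ ℓ)

-- The algebras obtained from a Boolean algebra by keeping meet and complement,
-- i.e. those that extend to a Boolean algebra with the same carrier, equality,
-- meet and complement.  The one-element Boolean algebra is included.

BA : ∀ {c ℓ} → Class c ℓ
BA A = Σ[ join ∈ Op₂ Carrier ] Σ[ ⊤ ∈ Carrier ] Σ[ ⊥ ∈ Carrier ]
         IsBooleanAlgebra _≃_ join meet compl ⊤ ⊥
  where open Algebra A

Defines : ∀ {c ℓ n} → Vec Identity n → Class c ℓ → Set (suc (c ⊔ ℓ))
Defines {c} {ℓ} Γ V =
  ∀ (A : Algebra c ℓ) → (∀ i → A ⊨ lookup Γ i) ⇔ V A

-- Entailment is semantic and ranges over algebras at the given levels.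

FollowsFromOthers : ∀ c ℓ {n} → Vec Identity n → Fin n → Set (suc (c ⊔ ℓ))
FollowsFromOthers c ℓ Γ i =
  ∀ (A : Algebra c ℓ) → (∀ j → j ≢ i → A ⊨ lookup Γ j) → A ⊨ lookup Γ i

Independent : ∀ c ℓ {n} → Vec Identity n → Set (suc (c ⊔ ℓ))
Independent c ℓ Γ = ∀ i → ¬ FollowsFromOthers c ℓ Γ i

-- Independence forces the entries of Γ to be pairwise distinct (a repeated
-- entry follows from its copy), so Γ has exactly n identities.

IsBase : ∀ {c ℓ} n → Vec Identity n → Class c ℓ → Set (suc (c ⊔ ℓ))
IsBase {c} {ℓ} n Γ V = Independent c ℓ Γ × Defines Γ V

x y z : Term
x = var 0
y = var 1
z = var 2

A8 J5′ : Identity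
A8  = x ∧ (y ∧ z) ≈ (z ∧ x) ∧ y
J5′ = x ≈ (x ′ ∧ y) ′ ∧ (x ′ ∧ y ′) ′

{-# OPTIONS --safe #-}

-- By J5′ every element is a product, hence a product of arbitrarily many
-- factors.  A8 lets any product of five factors be permuted and rebracketed
-- freely, so it makes meet commutative and associative.  J5′ is then
-- Huntington's equation, written for meet, and Huntington's theorem applies.

module Submission where

open import Defs
open import Algebra.Bundles using (Magma; CommutativeSemigroup)
open import Algebra.Core using (Op₁; Op₂)
open import Algebra.Definitions using (Congruent₁)
open import Algebra.Lattice.Bundles using (BooleanAlgebra)
open import Algebra.Lattice.Structures using (IsBooleanAlgebra)
open import Algebra.Structures using (IsCommutativeMonoid)
import Algebra.Consequences.Setoid
import Algebra.Lattice.Properties.BooleanAlgebra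
import Algebra.Lattice.Structures.Biased
import Algebra.Properties.CommutativeSemigroup
open import Data.Bool using (Bool; true; false)
open import Data.Fin using (zero; suc)
open import Data.Nat using (ℕ; zero; suc)
open import Data.Product using (∃₂; _,_; proj₂)
open import Data.Vec using ([]; _∷_)
open import Function.Base using (const; id)
open import Function.Bundles using (mk⇔)
open import Level using (Level; Lift; lift; lower)
open import Relation.Binary.PropositionalEquality as ≡ using (_≡_; refl)
import Relation.Binary.Reasoning.Setoid
open import Relation.Nullary using (¬_; contradiction)

-- Commutativity and associativity from the cyclic law.

module CyclicAssociativity {c ℓ} (M : Magma c ℓ) where

  open Magma M renaming (_≈_ to _≃_)
  open Relation.Binary.Reasoning.Setoid setoid

  module _ (cyclic : ∀ a b c → (a ∙ (b ∙ c)) ≃ ((c ∙ a) ∙ b))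
           (factor : ∀ a → ∃₂ λ b c → a ≃ (b ∙ c))
           where

    -- Three nested factorisations of `y` make `a ∙ y` a product of five factors, enough for
    -- `cyclic`, used in both directions, to carry `a` from one end to the other.
    comm : ∀ a b → (a ∙ b) ≃ (b ∙ a)
    comm a y with factor y
    ... | b , y₁ , y≃ with factor y₁
    ... | c , y₂ , y₁≃ with factor y₂
    ... | d , e , y₂≃ = begin
      a ∙ y                      ≈⟨ ∙-congˡ y≃bcde ⟩
      a ∙ (b ∙ (c ∙ (d ∙ e)))    ≈⟨ cyclic a b (c ∙ (d ∙ e)) ⟩
      ((c ∙ (d ∙ e)) ∙ a) ∙ b    ≈⟨ ∙-congʳ (∙-congʳ (cyclic c d e)) ⟩
      (((e ∙ c) ∙ d) ∙ a) ∙ b    ≈⟨ ∙-congʳ (cyclic d a (e ∙ c)) ⟨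
      (d ∙ (a ∙ (e ∙ c))) ∙ b    ≈⟨ cyclic (a ∙ (e ∙ c)) b d ⟨
      (a ∙ (e ∙ c)) ∙ (b ∙ d)    ≈⟨ cyclic (e ∙ c) (b ∙ d) a ⟨
      (e ∙ c) ∙ ((b ∙ d) ∙ a)    ≈⟨ cyclic c ((b ∙ d) ∙ a) e ⟨
      c ∙ (((b ∙ d) ∙ a) ∙ e)    ≈⟨ ∙-congˡ (cyclic a e (b ∙ d)) ⟨
      c ∙ (a ∙ (e ∙ (b ∙ d)))    ≈⟨ cyclic c a (e ∙ (b ∙ d)) ⟩
      ((e ∙ (b ∙ d)) ∙ c) ∙ a    ≈⟨ ∙-congʳ (∙-congʳ (cyclic e b d)) ⟩
      (((d ∙ e) ∙ b) ∙ c) ∙ a    ≈⟨ ∙-congʳ (cyclic b c (d ∙ e)) ⟨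
      (b ∙ (c ∙ (d ∙ e))) ∙ a    ≈⟨ ∙-congʳ y≃bcde ⟨
      y ∙ a                      ∎
      where
      y≃bcde : y ≃ (b ∙ (c ∙ (d ∙ e)))
      y≃bcde = trans y≃ (∙-congˡ (trans y₁≃ (∙-congˡ y₂≃)))

    -- Splitting the two outer factors and keeping `c` whole again gives five factors.
    assoc : ∀ a b c → ((a ∙ b) ∙ c) ≃ (a ∙ (b ∙ c))
    assoc x c z with factor x | factor z
    ... | a , b , x≃ | d , e , z≃ = begin
      (x ∙ c) ∙ z                ≈⟨ ∙-cong (∙-congʳ x≃) z≃ ⟩
      ((a ∙ b) ∙ c) ∙ (d ∙ e)    ≈⟨ ∙-congʳ (cyclic b c a) ⟨
      (b ∙ (c ∙ a)) ∙ (d ∙ e)    ≈⟨ cyclic (b ∙ (c ∙ a)) d e ⟩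
      (e ∙ (b ∙ (c ∙ a))) ∙ d    ≈⟨ ∙-congʳ (cyclic e b (c ∙ a)) ⟩
      (((c ∙ a) ∙ e) ∙ b) ∙ d    ≈⟨ ∙-congʳ (∙-congʳ (cyclic a e c)) ⟨
      ((a ∙ (e ∙ c)) ∙ b) ∙ d    ≈⟨ cyclic b d (a ∙ (e ∙ c)) ⟨
      b ∙ (d ∙ (a ∙ (e ∙ c)))    ≈⟨ ∙-congˡ (cyclic d a (e ∙ c)) ⟩
      b ∙ (((e ∙ c) ∙ d) ∙ a)    ≈⟨ ∙-congˡ (∙-congʳ (cyclic c d e)) ⟨
      b ∙ ((c ∙ (d ∙ e)) ∙ a)    ≈⟨ cyclic b (c ∙ (d ∙ e)) a ⟩
      (a ∙ b) ∙ (c ∙ (d ∙ e))    ≈⟨ ∙-cong x≃ (∙-congˡ z≃) ⟨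
      x ∙ (c ∙ z)                ∎

    commutativeSemigroup : CommutativeSemigroup c ℓ
    commutativeSemigroup = record
      { isCommutativeSemigroup = record
        { isSemigroup = record { isMagma = isMagma ; assoc = assoc }
        ; comm        = comm
        }
      }

-- Huntington's theorem, stated for meet and complement.

module Huntington {c ℓ} (S : CommutativeSemigroup c ℓ) where

  open CommutativeSemigroup S
    renaming (_≈_ to _≃_; _∙_ to infixr 7 _⊓_; refl to ≃-refl; sym to ≃-sym)
  open Algebra.Properties.CommutativeSemigroup S
  open Relation.Binary.Reasoning.Setoid setoid
  open Algebra.Lattice.Structures.Biased _≃_

  module _ (_ᶜ : Op₁ Carrier) (ᶜ-cong : Congruent₁ _≃_ _ᶜ)
           (huntington : ∀ a b → a ≃ (a ᶜ ⊓ b) ᶜ ⊓ (a ᶜ ⊓ b ᶜ) ᶜ)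
           (point : Carrier)
           where

    -- Expanding the left side along `a ᶜ ᶜ` and the right side along `a ᶜ` produces the same four
    -- factors, up to order.
    ⊓-ᶜ-shift : ∀ a → a ⊓ a ᶜ ≃ a ᶜ ⊓ a ᶜ ᶜ
    ⊓-ᶜ-shift a = begin
      a ⊓ a ᶜ
        ≈⟨ ∙-cong (huntington a (a ᶜ ᶜ)) (huntington (a ᶜ) (a ᶜ ᶜ)) ⟩
      ((a ᶜ ⊓ a ᶜ ᶜ) ᶜ ⊓ (a ᶜ ⊓ a ᶜ ᶜ ᶜ) ᶜ) ⊓ ((a ᶜ ᶜ ⊓ a ᶜ ᶜ) ᶜ ⊓ (a ᶜ ᶜ ⊓ a ᶜ ᶜ ᶜ) ᶜ)
        ≈⟨ interchange _ _ _ _ ⟩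
      ((a ᶜ ⊓ a ᶜ ᶜ) ᶜ ⊓ (a ᶜ ᶜ ⊓ a ᶜ ᶜ) ᶜ) ⊓ ((a ᶜ ⊓ a ᶜ ᶜ ᶜ) ᶜ ⊓ (a ᶜ ᶜ ⊓ a ᶜ ᶜ ᶜ) ᶜ)
        ≈⟨ ∙-cong (∙-congʳ (ᶜ-cong (comm _ _))) (∙-cong (ᶜ-cong (comm _ _)) (ᶜ-cong (comm _ _))) ⟩
      ((a ᶜ ᶜ ⊓ a ᶜ) ᶜ ⊓ (a ᶜ ᶜ ⊓ a ᶜ ᶜ) ᶜ) ⊓ ((a ᶜ ᶜ ᶜ ⊓ a ᶜ) ᶜ ⊓ (a ᶜ ᶜ ᶜ ⊓ a ᶜ ᶜ) ᶜ)
        ≈⟨ ∙-cong (huntington (a ᶜ) (a ᶜ)) (huntington (a ᶜ ᶜ) (a ᶜ)) ⟨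
      a ᶜ ⊓ a ᶜ ᶜ ∎

    -- The expansions of `a ᶜ ᶜ` along `a ᶜ` and of `a` along `a ᶜ ᶜ` share one factor up to order;
    -- `⊓-ᶜ-shift (a ᶜ)` identifies the other.
    ᶜ-involutive : ∀ a → a ᶜ ᶜ ≃ a
    ᶜ-involutive a = begin
      a ᶜ ᶜ
        ≈⟨ huntington (a ᶜ ᶜ) (a ᶜ) ⟩
      (a ᶜ ᶜ ᶜ ⊓ a ᶜ) ᶜ ⊓ (a ᶜ ᶜ ᶜ ⊓ a ᶜ ᶜ) ᶜ
        ≈⟨ ∙-cong (ᶜ-cong (comm _ _)) (ᶜ-cong (trans (comm _ _) (≃-sym (⊓-ᶜ-shift (a ᶜ))))) ⟩
      (a ᶜ ⊓ a ᶜ ᶜ ᶜ) ᶜ ⊓ (a ᶜ ⊓ a ᶜ ᶜ) ᶜ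
        ≈⟨ comm _ _ ⟩
      (a ᶜ ⊓ a ᶜ ᶜ) ᶜ ⊓ (a ᶜ ⊓ a ᶜ ᶜ ᶜ) ᶜ
        ≈⟨ huntington a (a ᶜ ᶜ) ⟨
      a ∎

    huntingtonᶜ : ∀ a b → a ᶜ ≃ (a ⊓ b) ᶜ ⊓ (a ⊓ b ᶜ) ᶜ
    huntingtonᶜ a b = trans (huntington (a ᶜ) b)
      (∙-cong (ᶜ-cong (∙-congʳ (ᶜ-involutive a))) (ᶜ-cong (∙-congʳ (ᶜ-involutive a))))

    -- Both sides expand to the meet of the complements of all four (±a) ⊓ (±b).
    ⊓-ᶜ-constant : ∀ a b → a ⊓ a ᶜ ≃ b ⊓ b ᶜ
    ⊓-ᶜ-constant a b = begin
      a ⊓ a ᶜ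
        ≈⟨ ∙-cong (huntington a b) (huntingtonᶜ a b) ⟩
      ((a ᶜ ⊓ b) ᶜ ⊓ (a ᶜ ⊓ b ᶜ) ᶜ) ⊓ ((a ⊓ b) ᶜ ⊓ (a ⊓ b ᶜ) ᶜ)
        ≈⟨ comm _ _ ⟩
      ((a ⊓ b) ᶜ ⊓ (a ⊓ b ᶜ) ᶜ) ⊓ ((a ᶜ ⊓ b) ᶜ ⊓ (a ᶜ ⊓ b ᶜ) ᶜ)
        ≈⟨ interchange _ _ _ _ ⟩
      ((a ⊓ b) ᶜ ⊓ (a ᶜ ⊓ b) ᶜ) ⊓ ((a ⊓ b ᶜ) ᶜ ⊓ (a ᶜ ⊓ b ᶜ) ᶜ)
        ≈⟨ comm _ _ ⟩
      ((a ⊓ b ᶜ) ᶜ ⊓ (a ᶜ ⊓ b ᶜ) ᶜ) ⊓ ((a ⊓ b) ᶜ ⊓ (a ᶜ ⊓ b) ᶜ)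
        ≈⟨ ∙-cong (∙-cong (ᶜ-cong (comm _ _)) (ᶜ-cong (comm _ _)))
                  (∙-cong (ᶜ-cong (comm _ _)) (ᶜ-cong (comm _ _))) ⟩
      ((b ᶜ ⊓ a) ᶜ ⊓ (b ᶜ ⊓ a ᶜ) ᶜ) ⊓ ((b ⊓ a) ᶜ ⊓ (b ⊓ a ᶜ) ᶜ)
        ≈⟨ ∙-cong (huntington b a) (huntingtonᶜ b a) ⟨
      b ⊓ b ᶜ ∎

    -- Bounds, identity and idempotence.

    ⊥ ⊤ : Carrier
    -- By `⊓-ᶜ-constant`, every element yields the same bottom.
    ⊥ = point ⊓ point ᶜ
    ⊤ = ⊥ ᶜ

    ⊓-complementʳ : ∀ a → a ⊓ a ᶜ ≃ ⊥
    ⊓-complementʳ a = ⊓-ᶜ-constant a point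

    ⊓-complementˡ : ∀ a → a ᶜ ⊓ a ≃ ⊥
    ⊓-complementˡ a = trans (comm _ _) (⊓-complementʳ a)

    ⊤ᶜ≃⊥ : ⊤ ᶜ ≃ ⊥
    ⊤ᶜ≃⊥ = ᶜ-involutive ⊥

    -- Huntington's equation along `a` itself. Every element is thus a multiple of `⊤`, so the
    -- identity law reduces to `⊤ ⊓ ⊤ ≃ ⊤`.
    ⊤-split : ∀ a → a ≃ ⊤ ⊓ (a ᶜ ⊓ a ᶜ) ᶜ
    ⊤-split a = trans (huntington a a) (∙-congʳ (ᶜ-cong (⊓-complementˡ a)))

    ⊥⊓⊤≃⊥ : ⊥ ⊓ ⊤ ≃ ⊥
    ⊥⊓⊤≃⊥ = ⊓-complementʳ ⊥

    ⊤≃⊤⊓⟨⊥⊓⊥⟩ᶜ : ⊤ ≃ ⊤ ⊓ (⊥ ⊓ ⊥) ᶜ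
    ⊤≃⊤⊓⟨⊥⊓⊥⟩ᶜ = trans (⊤-split ⊤) (∙-congˡ (ᶜ-cong (∙-cong ⊤ᶜ≃⊥ ⊤ᶜ≃⊥)))

    -- Since `⊤` absorbs `u ᶜ`, so does `⊥ ≃ ⊥ ⊓ ⊤`. Hence the two factors of `u` along `⊤` collapse
    -- to `⊤ ᶜ` and `⊥ ᶜ`, which is `⊤`.
    ⊥⊓⊥≃⊥ : ⊥ ⊓ ⊥ ≃ ⊥
    ⊥⊓⊥≃⊥ = begin
      u                                ≈⟨ huntington u ⊤ ⟩
      (u ᶜ ⊓ ⊤) ᶜ ⊓ (u ᶜ ⊓ ⊤ ᶜ) ᶜ      ≈⟨ ∙-cong (ᶜ-cong (trans (comm _ _) (≃-sym ⊤≃⊤⊓⟨⊥⊓⊥⟩ᶜ)))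
                                                 (ᶜ-cong (trans (∙-congˡ ⊤ᶜ≃⊥) (trans (comm _ _) ⊥⊓uᶜ≃⊥))) ⟩
      ⊤ ᶜ ⊓ ⊤                          ≈⟨ ⊓-complementˡ ⊤ ⟩
      ⊥                                ∎
      where
      u = ⊥ ⊓ ⊥
      ⊥⊓uᶜ≃⊥ : ⊥ ⊓ u ᶜ ≃ ⊥
      ⊥⊓uᶜ≃⊥ = begin
        ⊥ ⊓ u ᶜ          ≈⟨ ∙-congʳ ⊥⊓⊤≃⊥ ⟨
        (⊥ ⊓ ⊤) ⊓ u ᶜ    ≈⟨ assoc _ _ _ ⟩
        ⊥ ⊓ (⊤ ⊓ u ᶜ)    ≈⟨ ∙-congˡ ⊤≃⊤⊓⟨⊥⊓⊥⟩ᶜ ⟨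
        ⊥ ⊓ ⊤            ≈⟨ ⊥⊓⊤≃⊥ ⟩
        ⊥                ∎

    ⊤⊓⊤≃⊤ : ⊤ ⊓ ⊤ ≃ ⊤
    ⊤⊓⊤≃⊤ = ≃-sym (trans ⊤≃⊤⊓⟨⊥⊓⊥⟩ᶜ (∙-congˡ (ᶜ-cong ⊥⊓⊥≃⊥)))

    ⊓-identityˡ : ∀ a → ⊤ ⊓ a ≃ a
    ⊓-identityˡ a = begin
      ⊤ ⊓ a                      ≈⟨ ∙-congˡ (⊤-split a) ⟩
      ⊤ ⊓ (⊤ ⊓ (a ᶜ ⊓ a ᶜ) ᶜ)    ≈⟨ assoc _ _ _ ⟨
      (⊤ ⊓ ⊤) ⊓ (a ᶜ ⊓ a ᶜ) ᶜ    ≈⟨ ∙-congʳ ⊤⊓⊤≃⊤ ⟩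
      ⊤ ⊓ (a ᶜ ⊓ a ᶜ) ᶜ          ≈⟨ ⊤-split a ⟨
      a                          ∎

    -- With the identity law, `⊤-split (a ᶜ)` reads `a ᶜ ≃ (a ᶜ ᶜ ⊓ a ᶜ ᶜ) ᶜ`; complement both
    -- sides.
    ⊓-idem : ∀ a → a ⊓ a ≃ a
    ⊓-idem a = begin
      a ⊓ a                    ≈⟨ ∙-cong (ᶜ-involutive a) (ᶜ-involutive a) ⟨
      a ᶜ ᶜ ⊓ a ᶜ ᶜ            ≈⟨ ᶜ-involutive _ ⟨
      (a ᶜ ᶜ ⊓ a ᶜ ᶜ) ᶜ ᶜ      ≈⟨ ᶜ-cong (trans (⊤-split (a ᶜ)) (⊓-identityˡ _)) ⟨
      a ᶜ ᶜ                    ≈⟨ ᶜ-involutive a ⟩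
      a                        ∎

    ⊓-zeroʳ : ∀ a → a ⊓ ⊥ ≃ ⊥
    ⊓-zeroʳ a = begin
      a ⊓ ⊥            ≈⟨ ∙-congˡ (⊓-complementʳ a) ⟨
      a ⊓ (a ⊓ a ᶜ)    ≈⟨ assoc _ _ _ ⟨
      (a ⊓ a) ⊓ a ᶜ    ≈⟨ ∙-congʳ (⊓-idem a) ⟩
      a ⊓ a ᶜ          ≈⟨ ⊓-complementʳ a ⟩
      ⊥                ∎

    -- The De Morgan join and the lattice laws.

    infixr 6 _⊔_
    _⊔_ : Op₂ Carrier
    a ⊔ b = (a ᶜ ⊓ b ᶜ) ᶜ

    ⊔-cong : ∀ {a b c d} → a ≃ b → c ≃ d → a ⊔ c ≃ b ⊔ d
    ⊔-cong p q = ᶜ-cong (∙-cong (ᶜ-cong p) (ᶜ-cong q))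

    ⊔-comm : ∀ a b → a ⊔ b ≃ b ⊔ a
    ⊔-comm a b = ᶜ-cong (comm _ _)

    ⊔-assoc : ∀ a b c → (a ⊔ b) ⊔ c ≃ a ⊔ (b ⊔ c)
    ⊔-assoc a b c = ᶜ-cong (begin
      (a ᶜ ⊓ b ᶜ) ᶜ ᶜ ⊓ c ᶜ    ≈⟨ ∙-congʳ (ᶜ-involutive _) ⟩
      (a ᶜ ⊓ b ᶜ) ⊓ c ᶜ        ≈⟨ assoc _ _ _ ⟩
      a ᶜ ⊓ (b ᶜ ⊓ c ᶜ)        ≈⟨ ∙-congˡ (ᶜ-involutive _) ⟨
      a ᶜ ⊓ (b ᶜ ⊓ c ᶜ) ᶜ ᶜ    ∎)

    -- The second Huntington factor of `a` along `b` is literally `a ⊔ b`, so idempotence absorbs a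
    -- further copy.
    ⊓-absorbs-⊔ : ∀ a b → a ⊓ (a ⊔ b) ≃ a
    ⊓-absorbs-⊔ a b = begin
      a ⊓ (a ⊔ b)                          ≈⟨ ∙-congʳ (huntington a b) ⟩
      ((a ᶜ ⊓ b) ᶜ ⊓ (a ⊔ b)) ⊓ (a ⊔ b)    ≈⟨ assoc _ _ _ ⟩
      (a ᶜ ⊓ b) ᶜ ⊓ ((a ⊔ b) ⊓ (a ⊔ b))    ≈⟨ ∙-congˡ (⊓-idem _) ⟩
      (a ᶜ ⊓ b) ᶜ ⊓ (a ⊔ b)                ≈⟨ huntington a b ⟨
      a                                    ∎

    ⊔-absorbs-⊓ : ∀ a b → a ⊔ (a ⊓ b) ≃ a
    ⊔-absorbs-⊓ a b = begin
      (a ᶜ ⊓ (a ⊓ b) ᶜ) ᶜ            ≈⟨ ᶜ-cong (∙-congˡ (ᶜ-cong (∙-cong (ᶜ-involutive a) (ᶜ-involutive b)))) ⟨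
      (a ᶜ ⊓ (a ᶜ ⊔ b ᶜ)) ᶜ          ≈⟨ ᶜ-cong (⊓-absorbs-⊔ (a ᶜ) (b ᶜ)) ⟩
      a ᶜ ᶜ                          ≈⟨ ᶜ-involutive a ⟩
      a                              ∎

    -- Order, residuation and distributivity.

    infix 4 _≤_
    _≤_ : Carrier → Carrier → Set ℓ
    a ≤ b = a ⊓ b ≃ a

    -- The hypotheses let `d` absorb `a` and `b` under join, so `d` may be rewritten as
    -- `(a ⊔ b) ⊔ d`, and absorption finishes.
    ⊔-least : ∀ {a b d} → a ≤ d → b ≤ d → a ⊔ b ≤ d
    ⊔-least {a} {b} {d} a≤d b≤d = begin
      (a ⊔ b) ⊓ d                ≈⟨ ∙-congˡ (absorb a≤d) ⟨
      (a ⊔ b) ⊓ (a ⊔ d)          ≈⟨ ∙-congˡ (⊔-cong ≃-refl (absorb b≤d)) ⟨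
      (a ⊔ b) ⊓ (a ⊔ (b ⊔ d))    ≈⟨ ∙-congˡ (⊔-assoc a b d) ⟨
      (a ⊔ b) ⊓ ((a ⊔ b) ⊔ d)    ≈⟨ ⊓-absorbs-⊔ (a ⊔ b) d ⟩
      a ⊔ b                      ∎
      where
      absorb : ∀ {e} → e ≤ d → e ⊔ d ≃ d
      absorb {e} e≤d = begin
        e ⊔ d          ≈⟨ ⊔-comm e d ⟩
        d ⊔ e          ≈⟨ ⊔-cong ≃-refl (trans (comm d e) e≤d) ⟨
        d ⊔ (d ⊓ e)    ≈⟨ ⊔-absorbs-⊓ d e ⟩
        d              ∎

    -- Disjointness turns the first factor of `huntingtonᶜ a b` into `⊤`, leaving
    -- `a ᶜ ≃ (a ⊓ b ᶜ) ᶜ`.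
    disjoint⇒≤ᶜ : ∀ {a b} → a ⊓ b ≃ ⊥ → a ≤ b ᶜ
    disjoint⇒≤ᶜ {a} {b} ab≃⊥ = begin
      a ⊓ b ᶜ                            ≈⟨ ᶜ-involutive _ ⟨
      (a ⊓ b ᶜ) ᶜ ᶜ                      ≈⟨ ᶜ-cong (⊓-identityˡ _) ⟨
      (⊤ ⊓ (a ⊓ b ᶜ) ᶜ) ᶜ                ≈⟨ ᶜ-cong (∙-congʳ (ᶜ-cong ab≃⊥)) ⟨
      ((a ⊓ b) ᶜ ⊓ (a ⊓ b ᶜ) ᶜ) ᶜ        ≈⟨ ᶜ-cong (huntingtonᶜ a b) ⟨
      a ᶜ ᶜ                              ≈⟨ ᶜ-involutive a ⟩
      a                                  ∎

    ≤ᶜ⇒disjoint : ∀ {a b} → a ≤ b ᶜ → a ⊓ b ≃ ⊥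
    ≤ᶜ⇒disjoint {a} {b} a≤bᶜ = begin
      a ⊓ b            ≈⟨ ∙-congʳ a≤bᶜ ⟨
      (a ⊓ b ᶜ) ⊓ b    ≈⟨ assoc _ _ _ ⟩
      a ⊓ (b ᶜ ⊓ b)    ≈⟨ ∙-congˡ (⊓-complementˡ b) ⟩
      a ⊓ ⊥            ≈⟨ ⊓-zeroʳ a ⟩
      ⊥                ∎

    ⊓-monoʳ-≤ : ∀ a {b d} → b ≤ d → a ⊓ b ≤ a ⊓ d
    ⊓-monoʳ-≤ a {b} {d} b≤d = trans (interchange a b a d) (∙-cong (⊓-idem a) b≤d)

    ≤-⊔ˡ : ∀ a b → a ≤ a ⊔ b
    ≤-⊔ˡ = ⊓-absorbs-⊔

    ≤-⊔ʳ : ∀ a b → b ≤ a ⊔ b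
    ≤-⊔ʳ a b = trans (∙-congˡ (⊔-comm a b)) (⊓-absorbs-⊔ b a)

    -- a ⊓ b ≤ w amounts to b ≤ (a ⊓ w ᶜ) ᶜ, so meeting with a preserves joins.
    ⊓-distribˡ-⊔ : ∀ a b d → a ⊓ (b ⊔ d) ≃ (a ⊓ b) ⊔ (a ⊓ d)
    ⊓-distribˡ-⊔ a b d = begin
      a ⊓ (b ⊔ d)        ≈⟨ residual⁻¹ (⊔-least (residual (≤-⊔ˡ _ _)) (residual (≤-⊔ʳ _ _))) ⟨
      (a ⊓ (b ⊔ d)) ⊓ w  ≈⟨ comm _ _ ⟩
      w ⊓ (a ⊓ (b ⊔ d))  ≈⟨ ⊔-least (⊓-monoʳ-≤ a (≤-⊔ˡ b d)) (⊓-monoʳ-≤ a (≤-⊔ʳ b d)) ⟩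
      w                  ∎
      where
      w = (a ⊓ b) ⊔ (a ⊓ d)

      residual : ∀ {e} → a ⊓ e ≤ w → e ≤ (a ⊓ w ᶜ) ᶜ
      residual {e} ae≤w = disjoint⇒≤ᶜ (trans (x∙yz≈yx∙z e a (w ᶜ))
        (≤ᶜ⇒disjoint (trans (∙-congˡ (ᶜ-involutive w)) ae≤w)))

      residual⁻¹ : ∀ {e} → e ≤ (a ⊓ w ᶜ) ᶜ → a ⊓ e ≤ w
      residual⁻¹ {e} e≤ = trans (∙-congˡ (≃-sym (ᶜ-involutive w)))
        (disjoint⇒≤ᶜ (trans (≃-sym (x∙yz≈yx∙z e a (w ᶜ))) (≤ᶜ⇒disjoint e≤)))

    -- The library's biased structures ask for a join distributing over a meet,
    -- so the dual algebra is built and then turned around.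
    ⊓-⊔-isBooleanAlgebra : IsBooleanAlgebra _≃_ _⊓_ _⊔_ _ᶜ ⊥ ⊤
    ⊓-⊔-isBooleanAlgebra = isBooleanAlgebraʳ record
      { isDistributiveLattice = isDistributiveLatticeʳʲᵐ record
        { isLattice = record
          { isEquivalence = isEquivalence
          ; ∨-comm        = comm
          ; ∨-assoc       = assoc
          ; ∨-cong        = ∙-cong
          ; ∧-comm        = ⊔-comm
          ; ∧-assoc       = ⊔-assoc
          ; ∧-cong        = ⊔-cong
          ; absorptive    = ⊓-absorbs-⊔ , ⊔-absorbs-⊓
          }
        ; ∨-distribʳ-∧ = Algebra.Consequences.Setoid.comm∧distrˡ⇒distrʳ setoid
                           ⊔-cong comm ⊓-distribˡ-⊔
        }
      ; ∨-complementʳ = ⊓-complementʳ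
      ; ∧-complementʳ = λ a → ᶜ-cong (⊓-complementʳ (a ᶜ))
      ; ¬-cong        = ᶜ-cong
      }

    isBooleanAlgebra : IsBooleanAlgebra _≃_ _⊔_ _⊓_ _ᶜ ⊤ ⊥
    isBooleanAlgebra = ∧-∨-isBooleanAlgebra
      where
      dual : BooleanAlgebra c ℓ
      dual = record { isBooleanAlgebra = ⊓-⊔-isBooleanAlgebra }

      open Algebra.Lattice.Properties.BooleanAlgebra dual

-- Models of the two identities are Boolean algebras.

private
  variable
    c ℓ : Level

-- Both identities use only variables 0, 1 and 2; the last value also fills every later index.
assign : ∀ {A : Set c} → A → A → A → ℕ → A
assign a b d 0             = a
assign a b d 1             = b
assign a b d (suc (suc _)) = d

A8∧J5′⇒BA : ∀ (A : Algebra c ℓ) → A ⊨ A8 → A ⊨ J5′ → BA A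
A8∧J5′⇒BA A a8 j5′ = _ , _ , _ , Huntington.isBooleanAlgebra meetSemigroup
  compl compl-cong (λ a b → j5′ (assign a b b)) point
  where
  open Algebra A

  meetMagma : Magma _ _
  meetMagma = record
    { isMagma = record { isEquivalence = isEquivalence ; ∙-cong = meet-cong } }

  meetSemigroup : CommutativeSemigroup _ _
  meetSemigroup = CyclicAssociativity.commutativeSemigroup meetMagma
    (λ a b d → a8 (assign a b d))
    -- `J5′` with both variables set to `a` exhibits `a` as a product.
    (λ a → _ , _ , j5′ (assign a a a))

-- Boolean algebras satisfy both identities.

module _ (A : Algebra c ℓ) (ba : BA A) where
  private
    B : BooleanAlgebra c ℓ
    B = record { isBooleanAlgebra = proj₂ (proj₂ (proj₂ ba)) }

  open BooleanAlgebra B renaming (_∧_ to _⊓_; _∨_ to _⊔_; _≈_ to _≃_; ¬_ to _ᶜ)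
  open Algebra.Lattice.Properties.BooleanAlgebra B
  open Relation.Binary.Reasoning.Setoid setoid

  BA⇒A8 : A ⊨ A8
  BA⇒A8 ρ = Algebra.Properties.CommutativeSemigroup.x∙yz≈zx∙y
    (record { isCommutativeSemigroup = IsCommutativeMonoid.isCommutativeSemigroup ∧-⊤-isCommutativeMonoid })
    (ρ 0) (ρ 1) (ρ 2)

  -- Join `a` with the bottom element in the form `b ᶜ ⊓ b ᶜ ᶜ`, distribute, and read De Morgan
  -- backwards.
  BA⇒J5′ : A ⊨ J5′
  BA⇒J5′ ρ = begin
    a                                    ≈⟨ ∨-identityʳ a ⟨
    a ⊔ ⊥                                ≈⟨ ∨-congˡ (∧-complementʳ (b ᶜ)) ⟨
    a ⊔ (b ᶜ ⊓ b ᶜ ᶜ)                    ≈⟨ ∨-distribˡ-∧ a (b ᶜ) (b ᶜ ᶜ) ⟩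
    (a ⊔ b ᶜ) ⊓ (a ⊔ b ᶜ ᶜ)              ≈⟨ ∧-cong (∨-congʳ (¬-involutive a)) (∨-congʳ (¬-involutive a)) ⟨
    (a ᶜ ᶜ ⊔ b ᶜ) ⊓ (a ᶜ ᶜ ⊔ b ᶜ ᶜ)      ≈⟨ ∧-cong (deMorgan₁ (a ᶜ) b) (deMorgan₁ (a ᶜ) (b ᶜ)) ⟨
    (a ᶜ ⊓ b) ᶜ ⊓ (a ᶜ ⊓ b ᶜ) ᶜ          ∎
    where
    a = ρ 0
    b = ρ 1

-- Independence by two-element models.

boolAlgebra : Op₂ Bool → Op₁ Bool → Algebra c ℓ
boolAlgebra {c} {ℓ} _·_ f = record
  -- `Lift` moves the model to arbitrary levels, as independence is claimed at each of them.
  { Carrier       = Lift c Bool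
  ; _≃_           = λ a b → Lift ℓ (lower a ≡ lower b)
  ; isEquivalence = record
    { refl  = lift refl
    ; sym   = λ (lift p) → lift (≡.sym p)
    ; trans = λ (lift p) (lift q) → lift (≡.trans p q)
    }
  ; meet          = λ a b → lift (lower a · lower b)
  ; compl         = λ a → lift (f (lower a))
  ; meet-cong     = λ (lift p) (lift q) → lift (≡.cong₂ _·_ p q)
  ; compl-cong    = λ (lift p) → lift (≡.cong f p)
  ; point         = lift true
  }

-- Under a constant meet both sides of `A8` agree, but `false` is not a product.
A8⇏J5′ : ¬ FollowsFromOthers c ℓ (A8 ∷ J5′ ∷ []) (suc zero)
A8⇏J5′ entails
  with lift () ← entails (boolAlgebra (λ _ _ → true) id)
                   (λ where zero       _ _ → lift refl
                            (suc zero) 1≢1 → contradiction refl 1≢1)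
                   (λ _ → lift false)

-- With left projection as meet and identity as complement, `J5′` reads `x ≈ x`, while `A8` reads
-- `x ≈ z`.
J5′⇏A8 : ¬ FollowsFromOthers c ℓ (A8 ∷ J5′ ∷ []) zero
J5′⇏A8 entails
  with lift () ← entails (boolAlgebra const id)
                   (λ where zero       0≢0 → contradiction refl 0≢0
                            (suc zero) _ _ → lift refl)
                   (assign (lift true) (lift true) (lift false))

theorem5p1 : ∀ c ℓ → IsBase {c} {ℓ} 2 (A8 ∷ J5′ ∷ []) BA
theorem5p1 c ℓ = independent , λ A → mk⇔
  (λ A⊨Γ → A8∧J5′⇒BA A (A⊨Γ zero) (A⊨Γ (suc zero)))
  (λ where ba zero       → BA⇒A8 A ba
           ba (suc zero) → BA⇒J5′ A ba)
  where
  independent : Independent c ℓ (A8 ∷ J5′ ∷ [])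
  independent zero       = J5′⇏A8
  independent (suc zero) = A8⇏J5′
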